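{- The set $S = \{u_0,u_1,u_2,u_3,u_4,u_5,u_6\}$ is a zero forcing set of the generalized Petersen graph $P(12,3)$. Hence $Z(P(12,3)) \le 7$.
   Context: Let $G=(V,E)$ be a finite simple graph. Color a subset $S\subseteq V$ black and the remaining vertices white. Color change rule: a black vertex with exactly one white neighbor forces that neighbor to become black. Iterating this rule starting from $S$ until no further force is possible gives the closure $\mathrm{cl}(S)$. The set $S$ is a zero forcing set of $G$ if $\mathrm{cl}(S)=V$, and the zero forcing number $Z(G)$ is the minimum cardinality of a zero forcing set. For $n\ge 3$ and $1\le k<n/2$, the generalized Petersen graph $P(n,k)$ has the $2n$ vertices $\{u_0,\dots,u_{n-1}\}\cup\{v_0,\dots,v_{n-1}\}$ and edges $u_i\sim u_{i+1}$, $u_i\sim v_i$, and $v_i\sim v_{i+k}$ for all $i$, with indices taken modulo $n$. -}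

module Defs where

open import Level using (0ℓ)
open import Data.Fin using (Fin; toℕ; _↑ˡ_; _↑ʳ_; splitAt; _≟_)
open import Data.Fin.Properties
  using (any?; all?; toℕ-fromℕ<; ↑ˡ-injective; ↑ʳ-injective;
         splitAt-↑ˡ; splitAt-↑ʳ)
open import Data.Fin.Subset using (Subset; _∈_; _∉_; _⊆_; _⊃_; _∪_; ⁅_⁆; ⊤; ∣_∣)
open import Data.Fin.Subset.Properties
  using (_∈?_; ∈⊤; p⊆p∪q; q⊆p∪q; x∈⁅x⁆; x∈⁅y⁆⇒x≡y; x∈p∪q⁻; anySubset?; ⊆-antisym)
open import Data.Fin.Subset.Induction using (⊃-wellFounded)
open import Data.Nat using (ℕ; suc; z≤n; s≤s; _+_; _*_; _≤_; _<_; NonZero; >-nonZero)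
open import Data.Nat.DivMod using (_mod_; _%_; _/_; m≡m%n+[m/n]*n; m%n<n)
open import Data.Nat.Divisibility using (divides; ∣⇒≤)
open import Data.Nat.Induction using (<-wellFounded)
open import Data.Nat.Properties
  using (_≤?_; _<?_; ≮⇒≥; ≤-trans; ≤-<-trans; <⇒≱; +-cancelˡ-≡; ≤-refl; m≤m+n)
open import Data.Product using (∃; ∃₂; _×_; _,_; proj₁; proj₂)
open import Data.Sum using (_⊎_; inj₁; inj₂; swap)
import Data.Vec.Properties as Vec
import Data.Bool.Properties as Bool
open import Induction.WellFounded using (Acc; acc)
open import Relation.Binary using (Rel; Decidable; Symmetric; Irreflexive)
open import Relation.Binary.Construct.Closure.ReflexiveTransitive using (Star; ε; _◅_)
open import Relation.Binary.PropositionalEquality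
  using (_≡_; _≢_; refl; sym; trans; cong; subst; module ≡-Reasoning)
open import Relation.Nullary using (¬_; Dec; yes; no)
open import Relation.Nullary.Decidable
  using (True; toWitness; _×-dec_; _⊎-dec_; _→-dec_; ¬?; decidable-stable)

------------------------------------------------------------------------
-- Finite simple graphs

record Graph (m : ℕ) : Set₁ where
  infix 4 _~_ _~?_
  field
    _~_      : Rel (Fin m) 0ℓ
    _~?_     : Decidable _~_
    ~-sym    : Symmetric _~_
    ~-irrefl : Irreflexive _≡_ _~_

------------------------------------------------------------------------
-- Zero forcing; a colouring is given by its set of black vertices

module ZeroForcing {m : ℕ} (G : Graph m) where
  open Graph G

  Forces : Subset m → Fin m → Fin m → Set
  Forces B x y = x ∈ B × (x ~ y × y ∉ B) × (∀ z → x ~ z × z ∉ B → z ≡ y)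

  infix 4 _⟶_ _⟶*_

  _⟶_ : Rel (Subset m) 0ℓ
  B ⟶ B′ = ∃₂ λ x y → Forces B x y × B′ ≡ B ∪ ⁅ y ⁆

  _⟶*_ : Rel (Subset m) 0ℓ
  _⟶*_ = Star _⟶_

  Stable : Subset m → Set
  Stable B = ∀ x y → ¬ Forces B x y

  forces? : ∀ B x y → Dec (Forces B x y)
  forces? B x y =
    (x ∈? B) ×-dec ((x ~? y) ×-dec ¬? (y ∈? B)) ×-dec
    all? λ z → ((x ~? z) ×-dec ¬? (z ∈? B)) →-dec (z ≟ y)

  private
    grow : ∀ {B x y} → Forces B x y → (B ∪ ⁅ y ⁆) ⊃ B
    grow {B} {x} {y} (_ , (_ , y∉B) , _) =
      p⊆p∪q ⁅ y ⁆ , y , q⊆p∪q B ⁅ y ⁆ (x∈⁅x⁆ y) , y∉B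

    run : ∀ B → Acc _⊃_ B → ∃ λ C → B ⟶* C × Stable C
    run B (acc rs) with any? (λ x → any? (forces? B x))
    ... | no none = B , ε , λ x y f → none (x , y , f)
    ... | yes (x , y , f) with run (B ∪ ⁅ y ⁆) (rs (grow f))
    ...   | C , steps , stable = C , (x , y , f , refl) ◅ steps , stable

  -- Abstract so that the type checker does not run the colouring process;
  -- the type determines the closure (cl-unique).
  abstract
    closure : ∀ S → ∃ λ C → S ⟶* C × Stable C
    closure S = run S (⊃-wellFounded S)

  cl : Subset m → Subset m
  cl S = proj₁ (closure S)

  -- The closure does not depend on the order in which forces are performed.

  ⟶*-⊆ : ∀ {S C} → S ⟶* C → S ⊆ C
  ⟶*-⊆ ε z∈S = z∈S
  ⟶*-⊆ ((_ , y , _ , refl) ◅ steps) z∈S = ⟶*-⊆ steps (p⊆p∪q ⁅ y ⁆ z∈S)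

  ⟶*-stable-⊆ : ∀ {S C D} → S ⟶* C → S ⊆ D → Stable D → C ⊆ D
  ⟶*-stable-⊆ ε S⊆D _ = S⊆D
  ⟶*-stable-⊆ {S} {D = D} ((x , y , (x∈S , (x~y , _) , only) , refl) ◅ steps) S⊆D stable =
    ⟶*-stable-⊆ steps S∪y⊆D stable
    where
    y∈D : y ∈ D
    y∈D = decidable-stable (y ∈? D) λ y∉D → stable x y
      ( S⊆D x∈S , (x~y , y∉D)
      , λ z (x~z , z∉D) → only z (x~z , λ z∈S → z∉D (S⊆D z∈S)))

    S∪y⊆D : (S ∪ ⁅ y ⁆) ⊆ D
    S∪y⊆D z∈ with x∈p∪q⁻ S ⁅ y ⁆ z∈
    ... | inj₁ z∈S = S⊆D z∈S
    ... | inj₂ z∈y = subst (_∈ D) (sym (x∈⁅y⁆⇒x≡y y z∈y)) y∈D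

  cl-unique : ∀ {S C} → S ⟶* C → Stable C → cl S ≡ C
  cl-unique {S} steps stable with closure S
  ... | C′ , steps′ , stable′ = ⊆-antisym
    (⟶*-stable-⊆ steps′ (⟶*-⊆ steps) stable)
    (⟶*-stable-⊆ steps (⟶*-⊆ steps′) stable′)

  IsZeroForcingSet : Subset m → Set
  IsZeroForcingSet S = cl S ≡ ⊤

  isZeroForcingSet? : ∀ S → Dec (IsZeroForcingSet S)
  isZeroForcingSet? S = Vec.≡-dec Bool._≟_ (cl S) ⊤

  ⊤-stable : Stable ⊤
  ⊤-stable _ _ (_ , (_ , y∉⊤) , _) = y∉⊤ ∈⊤

  ⊤-isZeroForcingSet : IsZeroForcingSet ⊤
  ⊤-isZeroForcingSet = cl-unique ε ⊤-stable

  IsZeroForcingNumber : ℕ → Set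
  IsZeroForcingNumber z =
    (∃ λ S → IsZeroForcingSet S × ∣ S ∣ ≡ z) ×
    (∀ T → IsZeroForcingSet T → z ≤ ∣ T ∣)

  private
    minimise : ∀ S → IsZeroForcingSet S → Acc _<_ ∣ S ∣ → ∃ IsZeroForcingNumber
    minimise S zfs (acc rs)
      with anySubset? (λ T → isZeroForcingSet? T ×-dec (∣ T ∣ <? ∣ S ∣))
    ... | yes (T , zfsT , T<S) = minimise T zfsT (rs T<S)
    ... | no none = ∣ S ∣ , (S , zfs , refl) , λ T zfsT → ≮⇒≥ λ T<S → none (T , zfsT , T<S)

  -- Abstract because evaluating it would search all 2 ^ m subsets;
  -- IsZeroForcingNumber determines its value.
  abstract
    zeroForcingNumber : ∃ IsZeroForcingNumber
    zeroForcingNumber = minimise ⊤ ⊤-isZeroForcingSet (<-wellFounded _)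

  Z : ℕ
  Z = proj₁ zeroForcingNumber

open ZeroForcing public using (cl; IsZeroForcingSet; Z)

------------------------------------------------------------------------
-- Generalized Petersen graphs; the vertex set Fin (n + n) is the
-- disjoint union of the u i and the v i

u : ∀ {n} → Fin n → Fin (n + n)
u {n} i = i ↑ˡ n

v : ∀ {n} → Fin n → Fin (n + n)
v {n} i = n ↑ʳ i

module _ {n : ℕ} .{{_ : NonZero n}} where

  infixl 6 _⊕_

  _⊕_ : Fin n → ℕ → Fin n
  i ⊕ j = (toℕ i + j) mod n

  PetersenEdge : ℕ → Rel (Fin (n + n)) 0ℓ
  PetersenEdge k x y = ∃ λ i →
    (x ≡ u i × y ≡ u (i ⊕ 1)) ⊎
    (x ≡ u i × y ≡ v i) ⊎
    (x ≡ v i × y ≡ v (i ⊕ k))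

  petersenEdge? : ∀ k → Decidable (PetersenEdge k)
  petersenEdge? k x y = any? λ i →
    ((x ≟ u i) ×-dec (y ≟ u (i ⊕ 1))) ⊎-dec
    ((x ≟ u i) ×-dec (y ≟ v i)) ⊎-dec
    ((x ≟ v i) ×-dec (y ≟ v (i ⊕ k)))

  u≢v : ∀ (i j : Fin n) → u i ≢ v j
  u≢v i j eq
    with () ← trans (sym (splitAt-↑ˡ n i n)) (trans (cong (splitAt n) eq) (splitAt-↑ʳ n n j))

  ⊕-≢ : ∀ (i : Fin n) {j} → 1 ≤ j → j < n → i ≢ i ⊕ j
  ⊕-≢ i {suc j-1} _ j<n eq = <⇒≱ j<n (∣⇒≤ (divides (t / n) (+-cancelˡ-≡ (toℕ i) _ _ t≡)))
    where
    t = toℕ i + suc j-1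

    open ≡-Reasoning
    t≡ : t ≡ toℕ i + t / n * n
    t≡ = begin
      t                             ≡⟨ m≡m%n+[m/n]*n t n ⟩
      t % n + t / n * n             ≡⟨ cong (_+ t / n * n) (toℕ-fromℕ< (m%n<n t n)) ⟨
      toℕ (i ⊕ suc j-1) + t / n * n ≡⟨ cong (λ l → toℕ l + t / n * n) eq ⟨
      toℕ i + t / n * n             ∎

  petersenEdge-irrefl : ∀ {k} → 1 < n → 1 ≤ k → k < n → ∀ {x} → ¬ PetersenEdge k x x
  petersenEdge-irrefl 1<n _ _ (i , inj₁ (p , q)) =
    ⊕-≢ i ≤-refl 1<n (↑ˡ-injective n _ _ (trans (sym p) q))
  petersenEdge-irrefl _ _ _ (i , inj₂ (inj₁ (p , q))) = u≢v i i (trans (sym p) q)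
  petersenEdge-irrefl _ 1≤k k<n (i , inj₂ (inj₂ (p , q))) =
    ⊕-≢ i 1≤k k<n (↑ʳ-injective n _ _ (trans (sym p) q))

petersen : ∀ n k → 3 ≤ n → 1 ≤ k → 2 * k < n → Graph (n + n)
petersen n k 3≤n 1≤k 2k<n = record
  { _~_      = λ x y → PetersenEdge k x y ⊎ PetersenEdge k y x
  ; _~?_     = λ x y → petersenEdge? k x y ⊎-dec petersenEdge? k y x
  ; ~-sym    = swap
  ; ~-irrefl = λ { refl (inj₁ e) → irr e ; refl (inj₂ e) → irr e }
  }
  where
  instance
    n≢0 : NonZero n
    n≢0 = >-nonZero (≤-trans (s≤s z≤n) 3≤n)

  irr : ∀ {x} → ¬ PetersenEdge k x x
  irr = petersenEdge-irrefl (≤-trans (s≤s (s≤s z≤n)) 3≤n)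
          1≤k (≤-<-trans (m≤m+n k _) 2k<n)

P : ∀ n k {3≤n : True (3 ≤? n)} {1≤k : True (1 ≤? k)} {2k<n : True (2 * k <? n)} →
    Graph (n + n)
P n k {3≤n} {1≤k} {2k<n} = petersen n k (toWitness 3≤n) (toWitness 1≤k) (toWitness 2k<n)

{-# OPTIONS --safe #-}

-- The vertices u₁, …, u₅ force their spokes. On the inner 4-cycles, v₁ and v₄
-- then force v₁₀ and v₇, and v₂ and v₅ force v₁₁ and v₈; each of these four new
-- black vertices has only its outer neighbour left to force. The rest follows
-- along the outer cycle and its spokes.
module Submission where

open import Defs
open import Data.Fin using (Fin)
open import Data.Fin.Patterns using (0F; 1F; 2F; 3F; 4F; 5F; 6F; 7F; 8F; 9F)
open import Data.Fin.Subset using (Subset; ⁅_⁆; ⋃; ⊤; _∪_; ∣_∣)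
open import Data.List using (_∷_; []; map)
open import Data.Nat using (_≤_)
open import Data.Product using (_×_; _,_; proj₁; proj₂)
open import Relation.Binary.Construct.Closure.ReflexiveTransitive using (ε; _◅_)
open import Relation.Binary.PropositionalEquality using (refl)
open import Relation.Nullary.Decidable using (True; toWitness)

pattern 10F = Fin.suc 9F
pattern 11F = Fin.suc 10F

module _ {m} (G : Graph m) where
  open ZeroForcing G
    using (_⟶*_; cl-unique; ⊤-stable; zeroForcingNumber)

  -- `cl` is abstract and does not evaluate; since the order of forces is irrelevant, one explicit
  -- run pins it down.
  ⟶*⊤⇒isZeroForcingSet : ∀ {S} → S ⟶* ⊤ → IsZeroForcingSet G S
  ⟶*⊤⇒isZeroForcingSet steps = cl-unique steps ⊤-stable

  Z-minimal : ∀ T → IsZeroForcingSet G T → Z G ≤ ∣ T ∣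
  Z-minimal = proj₂ (proj₂ zeroForcingNumber)

S : Subset 24
S = ⋃ (map (λ i → ⁅ u {12} i ⁆) (0F ∷ 1F ∷ 2F ∷ 3F ∷ 4F ∷ 5F ∷ 6F ∷ []))

open ZeroForcing (P 12 3) using (_⟶_; _⟶*_; forces?)

S⟶*⊤ : S ⟶* ⊤
S⟶*⊤ =
  u₁₂ 1F ⇒ v₁₂ 1F ◅ u₁₂ 2F ⇒ v₁₂ 2F ◅ u₁₂ 3F ⇒ v₁₂ 3F ◅ u₁₂ 4F ⇒ v₁₂ 4F ◅ u₁₂ 5F ⇒ v₁₂ 5F ◅
  v₁₂ 1F ⇒ v₁₂ 10F ◅ v₁₂ 4F ⇒ v₁₂ 7F ◅ v₁₂ 2F ⇒ v₁₂ 11F ◅ v₁₂ 5F ⇒ v₁₂ 8F ◅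
  v₁₂ 7F ⇒ u₁₂ 7F ◅ v₁₂ 8F ⇒ u₁₂ 8F ◅ v₁₂ 10F ⇒ u₁₂ 10F ◅ v₁₂ 11F ⇒ u₁₂ 11F ◅
  -- u₀ and u₆ each had two white neighbours until u₁₁ and u₇ turned black. At `ε` the accumulated
  -- union evaluates to `⊤`.
  u₁₂ 0F ⇒ v₁₂ 0F ◅ u₁₂ 6F ⇒ v₁₂ 6F ◅ u₁₂ 8F ⇒ u₁₂ 9F ◅ u₁₂ 9F ⇒ v₁₂ 9F ◅ ε
  where
  u₁₂ v₁₂ : Fin 12 → Fin 24
  u₁₂ = u
  v₁₂ = v

  infix 6 _⇒_
  -- The implicit `f` makes the type checker verify each force by evaluating `forces?` on the
  -- current black set.
  _⇒_ : ∀ {B} x y {f : True (forces? B x y)} → B ⟶ (B ∪ ⁅ y ⁆)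
  (x ⇒ y) {f} = x , y , toWitness f , refl

lemma2 : IsZeroForcingSet (P 12 3) (⋃ (map (λ i → ⁅ u {12} i ⁆) (0F ∷ 1F ∷ 2F ∷ 3F ∷ 4F ∷ 5F ∷ 6F ∷ [])))
    × Z (P 12 3) ≤ 7
lemma2 = S-forces , Z-minimal (P 12 3) S S-forces
  where
  S-forces = ⟶*⊤⇒isZeroForcingSet (P 12 3) S⟶*⊤
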